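{- For Online Makespan Scheduling under Scenarios with $m=2$ machines and $K=2$ scenarios, there exists a deterministic online algorithm that is $\frac{5}{3}$-competitive.
   Context: Online Makespan Scheduling under Scenarios with parameters $m,K\in\mathbb N$ (known in advance): an instance consists of a number $n$ of jobs, processing times $p_j\ge 0$ for $j\in[n]=\{1,\dots,n\}$, and scenarios $S_1,\dots,S_K\subseteq[n]$. Neither $n$ nor the processing times are known in advance. Jobs are revealed one at a time in the order $1,2,\dots,n$; when job $j$ is revealed, the algorithm learns $p_j$ and the set of $k\in[K]$ with $j\in S_k$ (so it knows $p_1,\dots,p_j$ and $S_k\cap[j]$ for all $k$), and must then irrevocably assign $j$ to a machine $\tau(j)\in[m]$. With $J_i=\tau^{ -1}(i)$ and $p(S)=\sum_{j\in S}p_j$, the objective (makespan) is $\max_{k\in[K]}\max_{i\in[m]}p(J_i\cap S_k)$, to be minimized. A deterministic online algorithm is $\rho$-competitive if on every instance its makespan is at most $\rho$ times the minimum makespan over all partitions $J_1\dot\cup\dots\dot\cup J_m=[n]$ (the offline optimum).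
   Formalization: The processing times are taken to be nonnegative rational numbers instead of nonnegative real numbers. -}

module Defs where

open import Data.Nat using (ℕ)
open import Data.Fin using (Fin; _≟_)
open import Data.Bool using (Bool; true; false; if_then_else_)
open import Data.Product using (_×_; _,_; proj₁; proj₂)
open import Data.List using (List; []; _∷_; _++_; [_]; foldr; allFin; concatMap; map)
open import Data.Rational using (ℚ; 0ℚ; _+_; _⊔_)
open import Relation.Nullary.Decidable using (does)

-- A revealed job: its processing time p_j and its scenario membership
-- (the k-th entry is true iff j ∈ S_k).
Job : ℕ → Set
Job K = ℚ × (Fin K → Bool)

-- A deterministic online algorithm: given the list of previously revealed
-- jobs (in order 1,…,j-1) and the current job j, it picks a machine.
-- (Its own earlier decisions are a function of the history, so this is
-- exactly the information available.)
OnlineAlg : ℕ → ℕ → Set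
OnlineAlg m K = List (Job K) → Job K → Fin m

runFrom : ∀ {m K} → OnlineAlg m K → List (Job K) → List (Job K) → List (Job K × Fin m)
runFrom alg hist []       = []
runFrom alg hist (j ∷ js) = (j , alg hist j) ∷ runFrom alg (hist ++ [ j ]) js

run : ∀ {m K} → OnlineAlg m K → List (Job K) → List (Job K × Fin m)
run alg js = runFrom alg [] js

load : ∀ {m K} → List (Job K × Fin m) → Fin K → Fin m → ℚ
load []                     k i = 0ℚ
load (((p , s) , i') ∷ σ)   k i =
  (if s k then (if does (i' ≟ i) then p else 0ℚ) else 0ℚ) + load σ k i

-- makespan σ = max_{k ∈ [K]} max_{i ∈ [m]} p(J_i ∩ S_k)
-- (folded with 0 as base; all loads are ≥ 0 for nonnegative processing times)
makespan : ∀ {m K} → List (Job K × Fin m) → ℚ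
makespan {m} {K} σ =
  foldr _⊔_ 0ℚ (concatMap (λ k → map (λ i → load σ k i) (allFin m)) (allFin K))

{-# OPTIONS --safe #-}
module Submission where

-- Let P be the larger of the total processing times of the two scenarios, and
-- let M be twice the best lower bound on the optimum given by P / 2 and the
-- largest job.  It suffices to keep all loads at most 5M/6.  A job of a single
-- scenario fits on one of the machines; the danger is a job of both scenarios
-- arriving when scenario 1 is heavy on one machine and scenario 2 is heavy on
-- the other.  If two such loads x and y satisfy x + y ≤ 4P/3, this stays true
-- wherever a common job goes, and it leaves room for that job on one machine.
-- Otherwise y ≤ 2P/3, and common jobs are sent to the machine of x; by the time
-- x is about to exceed 5M/6, P has grown so much that x + y ≤ 4P/3.
-- A further restriction on loads above 2M/3 makes sure that jobs of a single
-- scenario can be placed without destroying this property.  The algorithm uses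
-- the first machine iff the resulting invariant survives; that it survives on
-- some machine is a statement of linear arithmetic.

open import Defs
open import Algebra.Bundles using (CommutativeMonoid)
open import Data.Bool using (true; false; if_then_else_)
open import Data.Empty using (⊥; ⊥-elim)
open import Data.Fin using (Fin; _≟_)
open import Data.Fin.Patterns using (0F; 1F; 2F; 3F; 4F; 5F; 6F; 7F; 8F)
open import Data.Integer using (+_)
open import Data.List using (List; []; _∷_; _++_; foldl; map)
open import Data.List.Properties using (foldl-++)
open import Data.List.Relation.Unary.All using (All; []; _∷_)
open import Data.Nat using (ℕ; zero; suc; NonZero)
open import Data.Product using (Σ; _×_; _,_; _,′_; proj₁)
open import Data.Rational using (ℚ; 0ℚ; _≤_; _<_; _+_; _*_; _/_; _⊔_)
open import Data.Rational.Properties hiding (_≟_)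
open import Data.Rational.Solver using (module +-*-Solver)
open import Data.Sum as Sum using (_⊎_; inj₁; inj₂)
open import Data.Vec as Vec using (Vec; []; _∷_; lookup)
open import Data.Vec.Properties using (lookup-map)
open import Function using (_∘_; case_of_)
open import Relation.Binary.PropositionalEquality using (_≡_; refl; sym; trans; cong; cong₂; subst; subst₂)
open import Relation.Nullary.Decidable using (Dec; yes; no; does; toWitness)

open import Algebra.Properties.CommutativeSemigroup
  (CommutativeMonoid.commutativeSemigroup +-0-commutativeMonoid) using (interchange)
open import Algebra.Solver.CommutativeMonoid.Normal +-0-commutativeMonoid
  using (Expr; var; id; _⊕_; Env; ⟦_⟧; normalise; correct)

private
  variable
    m n : ℕ

-- Linear arithmetic over ℚ

infixr 8 _⊠_
_⊠_ : ℕ → Expr n → Expr n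
zero  ⊠ e = id
suc k ⊠ e = e ⊕ (k ⊠ e)

data Strictness : Set where
  weak strict : Strictness

_⊔ˢ_ : Strictness → Strictness → Strictness
weak   ⊔ˢ s = s
strict ⊔ˢ s = strict

Compare : Strictness → ℚ → ℚ → Set
Compare weak   = _≤_
Compare strict = _<_

-- A record, so that the two sides can be inferred from a proof.
record Holds (s : Strictness) (ρ : Env n) (a b : Expr n) : Set where
  constructor holds
  field compare : Compare s (⟦ a ⟧ ρ) (⟦ b ⟧ ρ)
open Holds

module _ {ρ : Env n} where

  weaken : ∀ {s a b} → Holds s ρ a b → Holds weak ρ a b
  weaken {weak}   h         = h
  weaken {strict} (holds h) = holds (<⇒≤ h)

  infixl 6 _⊞_
  _⊞_ : ∀ {s t a b c d} → Holds s ρ a b → Holds t ρ c d → Holds (s ⊔ˢ t) ρ (a ⊕ c) (b ⊕ d)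
  _⊞_ {weak}   {weak}   (holds h) (holds k) = holds (+-mono-≤ h k)
  _⊞_ {weak}   {strict} (holds h) (holds k) = holds (+-mono-≤-< h k)
  _⊞_ {strict} {weak}   (holds h) (holds k) = holds (+-mono-<-≤ h k)
  _⊞_ {strict} {strict} (holds h) (holds k) = holds (+-mono-< h k)

  infixr 7 _·_
  -- The multiplier is nonzero, so that a strict inequality stays strict. `k ⊠ a` ends in `id`,
  -- whence the trivial inequality added at `k = 1`.
  _·_ : ∀ {s a b} (k : ℕ) .{{_ : NonZero k}} → Holds s ρ a b → Holds s ρ (k ⊠ a) (k ⊠ b)
  _·_ {weak}   1             h = h ⊞ holds ≤-refl
  _·_ {strict} 1             h = h ⊞ holds ≤-refl
  _·_ {weak}   (suc (suc k)) h = h ⊞ suc k · h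
  _·_ {strict} (suc (suc k)) h = h ⊞ suc k · h

  -- A normal form is the vector of coefficients, so on concrete expressions the premise is a linear
  -- identity that `refl` checks.
  normalise-sound : ∀ a b → normalise a ≡ normalise b → ⟦ a ⟧ ρ ≡ ⟦ b ⟧ ρ
  normalise-sound a b a≡b rewrite sym (correct a ρ) | sym (correct b ρ) | a≡b = refl

  refute : ∀ {a b} {A : Set} → Holds strict ρ a b → normalise a ≡ normalise b → A
  refute {a} {b} (holds a<b) a≡b = ⊥-elim (<-irrefl (normalise-sound a b a≡b) a<b)

  compareExpr : ∀ a b → Holds weak ρ a b ⊎ Holds strict ρ b a
  compareExpr a b with ⟦ a ⟧ ρ ≤? ⟦ b ⟧ ρ
  ... | yes a≤b = inj₁ (holds a≤b)
  ... | no  a≰b = inj₂ (holds (≰⇒> a≰b))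

  -- Farkas certificates: c ≤ d is a combination of the hypotheses with
  -- k (b - a) = d - c.
  linear : ∀ {s a b c d} (k : ℕ) .{{_ : NonZero k}} → Holds s ρ c d →
           normalise ((k ⊠ b) ⊕ c) ≡ normalise ((k ⊠ a) ⊕ d) → Holds weak ρ a b
  linear {a = a} {b} k h eq with compareExpr a b
  ... | inj₁ a≤b = a≤b
  ... | inj₂ b<a = refute (k · b<a ⊞ weaken h) eq

  linear< : ∀ {a b c d} (k : ℕ) .{{_ : NonZero k}} → Holds strict ρ c d →
            normalise ((k ⊠ b) ⊕ c) ≡ normalise ((k ⊠ a) ⊕ d) → Holds strict ρ a b
  linear< {a} {b} k h eq with compareExpr b a
  ... | inj₁ b≤a = refute (k · b≤a ⊞ h) eq
  ... | inj₂ a<b = a<b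

-- Decidable formulas of linear arithmetic

infix 4 _≼_ _≺_
infixr 3 _∧_
infixr 2 _∨_

data Formula (n : ℕ) : Set where
  atom    : Strictness → Expr n → Expr n → Formula n
  _∧_ _∨_ : Formula n → Formula n → Formula n

pattern _≼_ a b = atom weak a b
pattern _≺_ a b = atom strict a b

infix 1 _⊨_
_⊨_ : Env n → Formula n → Set
ρ ⊨ atom s a b = Holds s ρ a b
ρ ⊨ φ ∧ ψ      = (ρ ⊨ φ) × (ρ ⊨ ψ)
ρ ⊨ φ ∨ ψ      = (ρ ⊨ φ) ⊎ (ρ ⊨ ψ)

-- Negation is pushed down to the atoms, so that a failed condition is again made of inequalities
-- usable in certificates.
∁ : Formula n → Formula n
∁ (a ≼ b) = b ≺ a
∁ (a ≺ b) = b ≼ a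
∁ (φ ∧ ψ) = ∁ φ ∨ ∁ ψ
∁ (φ ∨ ψ) = ∁ φ ∧ ∁ ψ

decide : ∀ (φ : Formula n) {ρ} → (ρ ⊨ φ) ⊎ (ρ ⊨ ∁ φ)
decide (a ≼ b) = compareExpr a b
decide (a ≺ b) = Sum.swap (compareExpr b a)
decide (φ ∧ ψ) with decide φ | decide ψ
... | inj₁ p | inj₁ q = inj₁ (p , q)
... | inj₁ _ | inj₂ q = inj₂ (inj₂ q)
... | inj₂ p | _      = inj₂ (inj₁ p)
decide (φ ∨ ψ) with decide φ | decide ψ
... | inj₁ p | _      = inj₁ (inj₁ p)
... | inj₂ _ | inj₁ q = inj₁ (inj₂ q)
... | inj₂ p | inj₂ q = inj₂ (p , q)

∁-sound : ∀ (φ : Formula n) {ρ} → ρ ⊨ φ → ρ ⊨ ∁ φ → ⊥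
∁-sound (a ≼ b) (holds p) (holds q)     = <-irrefl refl (<-≤-trans q p)
∁-sound (a ≺ b) (holds p) (holds q)     = <-irrefl refl (<-≤-trans p q)
∁-sound (φ ∧ ψ) (p , q) (inj₁ r)        = ∁-sound φ p r
∁-sound (φ ∧ ψ) (p , q) (inj₂ r)        = ∁-sound ψ q r
∁-sound (φ ∨ ψ) (inj₁ p) (r , _)        = ∁-sound φ p r
∁-sound (φ ∨ ψ) (inj₂ q) (_ , r)        = ∁-sound ψ q r

-- Substitution

_[_]ᵉ : Expr m → Vec (Expr n) m → Expr n
var i   [ θ ]ᵉ = lookup θ i
id      [ θ ]ᵉ = id
(a ⊕ b) [ θ ]ᵉ = (a [ θ ]ᵉ) ⊕ (b [ θ ]ᵉ)

_[_] : Formula m → Vec (Expr n) m → Formula n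
atom s a b [ θ ] = atom s (a [ θ ]ᵉ) (b [ θ ]ᵉ)
(φ ∧ ψ)    [ θ ] = (φ [ θ ]) ∧ (ψ [ θ ])
(φ ∨ ψ)    [ θ ] = (φ [ θ ]) ∨ (ψ [ θ ])

eval : Env n → Vec (Expr n) m → Env m
eval ρ = Vec.map (λ e → ⟦ e ⟧ ρ)

module _ (ρ : Env n) (θ : Vec (Expr n) m) where

  ⟦[]⟧ : ∀ e → ⟦ e ⟧ (eval ρ θ) ≡ ⟦ e [ θ ]ᵉ ⟧ ρ
  ⟦[]⟧ (var i) = lookup-map i _ θ
  ⟦[]⟧ id      = refl
  ⟦[]⟧ (a ⊕ b) = cong₂ _+_ (⟦[]⟧ a) (⟦[]⟧ b)

  specialise : ∀ φ → eval ρ θ ⊨ φ → ρ ⊨ φ [ θ ]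
  specialise (atom s a b) (holds h) = holds (subst₂ (Compare s) (⟦[]⟧ a) (⟦[]⟧ b) h)
  specialise (φ ∧ ψ) (p , q)  = specialise φ p , specialise ψ q
  specialise (φ ∨ ψ) (inj₁ p) = inj₁ (specialise φ p)
  specialise (φ ∨ ψ) (inj₂ q) = inj₂ (specialise ψ q)

  generalise : ∀ φ → ρ ⊨ φ [ θ ] → eval ρ θ ⊨ φ
  generalise (atom s a b) (holds h) = holds (subst₂ (Compare s) (sym (⟦[]⟧ a)) (sym (⟦[]⟧ b)) h)
  generalise (φ ∧ ψ) (p , q)  = generalise φ p , generalise ψ q
  generalise (φ ∨ ψ) (inj₁ p) = inj₁ (generalise φ p)
  generalise (φ ∨ ψ) (inj₂ q) = inj₂ (generalise ψ q)

infix 0 _⊢_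
record _⊢_ (φ ψ : Formula n) : Set where
  constructor entails
  field entailed : ∀ {ρ} → ρ ⊨ φ → ρ ⊨ ψ
open _⊢_

-- An entailment proved for variables becomes available for arbitrary expressions. The symmetry
-- arguments below rest on this.
_at_ : ∀ {φ ψ : Formula m} {ρ : Env n} → φ ⊢ ψ → (θ : Vec (Expr n) m) → ρ ⊨ φ [ θ ] → ρ ⊨ ψ [ θ ]
_at_ {φ = φ} {ψ} {ρ} h θ = specialise ρ θ ψ ∘ entailed h ∘ generalise ρ θ φ

-- The invariant

-- Here x and y are loads of different scenarios on different machines.  For a
-- load w, v is the load of the other scenario on the same machine and y that of
-- the other scenario on the other machine.

Balanced : (x y P : Expr n) → Formula n
Balanced x y P = 3 ⊠ x ⊕ 3 ⊠ y ≼ 4 ⊠ P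

-- A common job p does not fit on top of x only if p > 5M/6 - x and p > 5P - 6x.
-- The two alternatives say that x + y + p ≤ 4 (P + p) / 3 if p is at least one of
-- these bounds: the pair is then balanced after adding p to y.
Lopsided : (x y P M : Expr n) → Formula n
Lopsided x y P M = 3 ⊠ y ≼ 2 ⊠ P ∧ (24 ⊠ x ⊕ 18 ⊠ y ≼ 24 ⊠ P ⊕ 5 ⊠ M ∨ 3 ⊠ x ⊕ y ≼ 3 ⊠ P)

Compatible : (x y P M : Expr n) → Formula n
Compatible x y P M = Balanced x y P ∨ Lopsided x y P M ∨ Lopsided y x P M

-- The threshold is the maximum of `2M/3` and `2P/3 + M/9`. It is chosen so that a job too heavy for
-- one machine in this sense is light on the other.
Light : (w P M : Expr n) → Formula n
Light w P M = 3 ⊠ w ≼ 2 ⊠ M ∨ 9 ⊠ w ≼ 6 ⊠ P ⊕ M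

-- Each of the last three alternatives keeps w and y compatible when y receives
-- a job of its scenario that does not fit on top of v.
Moderate : (w v y P M : Expr n) → Formula n
Moderate w v y P M =
  6 ⊠ w ≼ 5 ⊠ M ∧
  (9 ⊠ w ≼ 6 ⊠ P ⊕ M ∨ 3 ⊠ w ≼ 2 ⊠ y ⊕ 2 ⊠ M ∨ 18 ⊠ w ≼ 18 ⊠ v ⊕ 5 ⊠ M)

Basic : (l₁ r₁ l₂ r₂ P M : Expr n) → Formula n
Basic l₁ r₁ l₂ r₂ P M =
  id ≼ l₁ ∧ id ≼ r₁ ∧ id ≼ l₂ ∧ id ≼ r₂ ∧ l₁ ⊕ r₁ ≼ P ∧ l₂ ⊕ r₂ ≼ P ∧ P ≼ M

Invariant : (l₁ r₁ l₂ r₂ P M : Expr n) → Formula n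
Invariant l₁ r₁ l₂ r₂ P M =
  Basic l₁ r₁ l₂ r₂ P M ∧
  Compatible l₁ r₂ P M ∧ Compatible r₁ l₂ P M ∧
  Moderate l₁ l₂ r₂ P M ∧ Moderate r₁ r₂ l₂ P M ∧
  Moderate l₂ l₁ r₁ P M ∧ Moderate r₂ r₁ l₁ P M

-- Monotonicity and symmetries of the invariant

module _ where
  private
    x y P M P′ M′ : Expr 6
    x = var 0F; y = var 1F; P = var 2F; M = var 3F; P′ = var 4F; M′ = var 5F

  lopsided-mono : (P ≼ P′ ∧ M ≼ M′) ∧ Lopsided x y P M ⊢ Lopsided x y P′ M′
  lopsided-mono = entails λ where
    ((P≤ , M≤) , y≤P , inj₁ h) → linear 1 (2 · P≤ ⊞ y≤P) refl , inj₁ (linear 1 (24 · P≤ ⊞ 5 · M≤ ⊞ h) refl)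
    ((P≤ , M≤) , y≤P , inj₂ h) → linear 1 (2 · P≤ ⊞ y≤P) refl , inj₂ (linear 1 (3 · P≤ ⊞ h) refl)

  compatible-mono : (P ≼ P′ ∧ M ≼ M′) ∧ Compatible x y P M ⊢ Compatible x y P′ M′
  compatible-mono = entails λ where
    ((P≤ , M≤) , inj₁ h) → inj₁ (linear 1 (4 · P≤ ⊞ h) refl)
    (≤ , inj₂ (inj₁ h))  → inj₂ (inj₁ (entailed lopsided-mono (≤ , h)))
    (≤ , inj₂ (inj₂ h)) →
      inj₂ (inj₂ ((lopsided-mono at (y ∷ x ∷ P ∷ M ∷ P′ ∷ M′ ∷ [])) (≤ , h)))

  compatible-sym : Compatible x y P M ⊢ Compatible y x P M
  compatible-sym = entails λ where
    (inj₁ h)        → inj₁ (linear 1 h refl)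
    (inj₂ (inj₁ h)) → inj₂ (inj₂ h)
    (inj₂ (inj₂ h)) → inj₂ (inj₁ h)

module _ where
  private
    w v y P M v′ y′ P′ M′ : Expr 9
    w = var 0F; v = var 1F; y = var 2F; P = var 3F; M = var 4F
    v′ = var 5F; y′ = var 6F; P′ = var 7F; M′ = var 8F

  -- Everything but `w` occurs only on the larger sides. Hence a job endangers the moderation only
  -- of loads it is added to.
  moderate-mono : v ≼ v′ ∧ y ≼ y′ ∧ P ≼ P′ ∧ M ≼ M′ ∧ Moderate w v y P M ⊢ Moderate w v′ y′ P′ M′
  moderate-mono = entails λ where
    (v≤ , y≤ , P≤ , M≤ , w≤M , h) → linear 1 (5 · M≤ ⊞ w≤M) refl , (case h of λ where
      (inj₁ k)        → inj₁ (linear 1 (6 · P≤ ⊞ M≤ ⊞ k) refl)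
      (inj₂ (inj₁ k)) → inj₂ (inj₁ (linear 1 (2 · y≤ ⊞ 2 · M≤ ⊞ k) refl))
      (inj₂ (inj₂ k)) → inj₂ (inj₂ (linear 1 (18 · v≤ ⊞ 5 · M≤ ⊞ k) refl)))

module _ where
  private
    w v y P M : Expr 5
    w = var 0F; v = var 1F; y = var 2F; P = var 3F; M = var 4F

  light⇒moderate : id ≼ y ∧ id ≼ M ∧ P ≼ M ∧ Light w P M ⊢ Moderate w v y P M
  light⇒moderate = entails λ where
    (0≤y , 0≤M , P≤M , inj₁ h) → linear 1 (0≤M ⊞ 2 · h) refl , inj₂ (inj₁ (linear 1 (2 · 0≤y ⊞ h) refl))
    (0≤y , 0≤M , P≤M , inj₂ h) → linear 3 (0≤M ⊞ 12 · P≤M ⊞ 2 · h) refl , inj₁ h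

  immoderate⇒heavy : id ≼ y ∧ id ≼ M ∧ P ≼ M ∧ ∁ (Moderate w v y P M) ⊢ ∁ (Light w P M)
  immoderate⇒heavy = entails λ where
    (0≤y , 0≤M , P≤M , ¬m) → case decide (Light w P M) of λ where
      (inj₁ l)  → ⊥-elim (∁-sound (Moderate w v y P M) (entailed light⇒moderate (0≤y , 0≤M , P≤M , l)) ¬m)
      (inj₂ ¬l) → ¬l

module _ where
  private
    l₁ r₁ l₂ r₂ P M P′ M′ : Expr 8
    l₁ = var 0F; r₁ = var 1F; l₂ = var 2F; r₂ = var 3F; P = var 4F; M = var 5F
    P′ = var 6F; M′ = var 7F

  invariant-mono : P ≼ P′ ∧ M ≼ M′ ∧ P′ ≼ M′ ∧ Invariant l₁ r₁ l₂ r₂ P M ⊢ Invariant l₁ r₁ l₂ r₂ P′ M′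
  invariant-mono = entails λ {ρ} → λ where
    (P≤ , M≤ , P′≤M′ ,
     (0≤l₁ , 0≤r₁ , 0≤l₂ , 0≤r₂ , T₁≤P , T₂≤P , P≤M) , c₁ , c₂ , m₁ , m₂ , m₃ , m₄) →
      let compatible : ∀ x y → ρ ⊨ Compatible x y P M → ρ ⊨ Compatible x y P′ M′
          compatible x y c = (compatible-mono at (x ∷ y ∷ P ∷ M ∷ P′ ∷ M′ ∷ [])) ((P≤ , M≤) , c)
          moderate : ∀ w v y → ρ ⊨ Moderate w v y P M → ρ ⊨ Moderate w v y P′ M′
          moderate w v y m = (moderate-mono at (w ∷ v ∷ y ∷ P ∷ M ∷ v ∷ y ∷ P′ ∷ M′ ∷ []))
                               (holds ≤-refl , holds ≤-refl , P≤ , M≤ , m)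
      in
      (0≤l₁ , 0≤r₁ , 0≤l₂ , 0≤r₂ , linear 1 (P≤ ⊞ T₁≤P) refl , linear 1 (P≤ ⊞ T₂≤P) refl , P′≤M′) ,
      compatible l₁ r₂ c₁ , compatible r₁ l₂ c₂ ,
      moderate l₁ l₂ r₂ m₁ , moderate r₁ r₂ l₂ m₂ , moderate l₂ l₁ r₁ m₃ , moderate r₂ r₁ l₁ m₄

module _ where
  private
    l₁ r₁ l₂ r₂ P M : Expr 6
    l₁ = var 0F; r₁ = var 1F; l₂ = var 2F; r₂ = var 3F; P = var 4F; M = var 5F

  swap-machines : Invariant l₁ r₁ l₂ r₂ P M ⊢ Invariant r₁ l₁ r₂ l₂ P M
  swap-machines = entails λ where
    ((0≤l₁ , 0≤r₁ , 0≤l₂ , 0≤r₂ , T₁≤P , T₂≤P , P≤M) , c₁ , c₂ , m₁ , m₂ , m₃ , m₄) →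
      (0≤r₁ , 0≤l₁ , 0≤r₂ , 0≤l₂ , linear 1 T₁≤P refl , linear 1 T₂≤P refl , P≤M) ,
      c₂ , c₁ , m₂ , m₁ , m₄ , m₃

  swap-scenarios : Invariant l₁ r₁ l₂ r₂ P M ⊢ Invariant l₂ r₂ l₁ r₁ P M
  swap-scenarios = entails λ where
    ((0≤l₁ , 0≤r₁ , 0≤l₂ , 0≤r₂ , T₁≤P , T₂≤P , P≤M) , c₁ , c₂ , m₁ , m₂ , m₃ , m₄) →
      (0≤l₂ , 0≤r₂ , 0≤l₁ , 0≤r₁ , T₂≤P , T₁≤P , P≤M) ,
      (compatible-sym at (r₁ ∷ l₂ ∷ P ∷ M ∷ P ∷ M ∷ [])) c₂ ,
      (compatible-sym at (l₁ ∷ r₂ ∷ P ∷ M ∷ P ∷ M ∷ [])) c₁ , m₃ , m₄ , m₁ , m₂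

-- One step of the algorithm

module _ where
  private
    l₁ r₁ l₂ r₂ P M p : Expr 7
    l₁ = var 0F; r₁ = var 1F; l₂ = var 2F; r₂ = var 3F; P = var 4F; M = var 5F
    p = var 6F

    machines scenarios : Vec (Expr 7) 7
    machines  = r₁ ∷ l₁ ∷ r₂ ∷ l₂ ∷ P ∷ M ∷ p ∷ []
    scenarios = l₂ ∷ r₂ ∷ l₁ ∷ r₁ ∷ P ∷ M ∷ p ∷ []

    current : Vec (Expr 7) 6
    current = l₁ ∷ r₁ ∷ l₂ ∷ r₂ ∷ P ∷ M ∷ []

  -- The sum of `l₁ + p` and `r₁ + p` is at most `P + M/2`, which leaves less than `P/3 + 7M/18` for
  -- `r₁ + p`. This is at most `2M/3` if `P ≤ 5M/6`, and at most `2P/3 + M/9` otherwise.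
  light-elsewhere : p ⊕ p ≼ M ∧ l₁ ⊕ r₁ ⊕ p ≼ P ∧ ∁ (Light (l₁ ⊕ p) P M) ⊢ Light (r₁ ⊕ p) P M
  light-elsewhere = entails λ where
    (p≤M , T≤P , _ , ¬l) → case decide (6 ⊠ P ≼ 5 ⊠ M) of λ where
      (inj₁ P≤) → inj₁ (linear 6 (9 · p≤M ⊞ 18 · T≤P ⊞ 2 · ¬l ⊞ P≤) refl)
      (inj₂ P>) → inj₂ (linear 2 (9 · p≤M ⊞ 18 · T≤P ⊞ 2 · ¬l ⊞ P>) refl)

  -- Jobs of a single scenario

  Single : Formula 7
  Single = Invariant l₁ r₁ l₂ r₂ P M ∧ id ≼ p ∧ p ⊕ p ≼ M ∧ l₁ ⊕ r₁ ⊕ p ≼ P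

  -- Only the load that grows and its cross pair have to be checked; the rest is unchanged or
  -- monotone.
  single-left : Single ∧ Moderate (l₁ ⊕ p) l₂ r₂ P M ∧ Compatible (l₁ ⊕ p) r₂ P M ⊢
                Invariant (l₁ ⊕ p) r₁ l₂ r₂ P M
  single-left = entails λ where
    ((((0≤l₁ , 0≤r₁ , 0≤l₂ , 0≤r₂ , T₁≤P , T₂≤P , P≤M) , c₁ , c₂ , m₁ , m₂ , m₃ , m₄) , 0≤p , p≤M , T≤P) , m , c) →
      (linear 1 (0≤l₁ ⊞ 0≤p) refl , 0≤r₁ , 0≤l₂ , 0≤r₂ , linear 1 T≤P refl , T₂≤P , P≤M) ,
      c , c₂ , m , m₂ ,
      (moderate-mono at (l₂ ∷ l₁ ∷ r₁ ∷ P ∷ M ∷ (l₁ ⊕ p) ∷ r₁ ∷ P ∷ M ∷ []))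
        (linear 1 0≤p refl , holds ≤-refl , holds ≤-refl , holds ≤-refl , m₃) ,
      (moderate-mono at (r₂ ∷ r₁ ∷ l₁ ∷ P ∷ M ∷ r₁ ∷ (l₁ ⊕ p) ∷ P ∷ M ∷ []))
        (holds ≤-refl , linear 1 0≤p refl , holds ≤-refl , holds ≤-refl , m₄)

  single-swap : Single ⊢ Single [ machines ]
  single-swap = entails λ where
    (inv , 0≤p , p≤M , T≤P) → (swap-machines at current) inv , 0≤p , p≤M , linear 1 T≤P refl

  single-right : Single ∧ Moderate (r₁ ⊕ p) r₂ l₂ P M ∧ Compatible (r₁ ⊕ p) l₂ P M ⊢
                 Invariant l₁ (r₁ ⊕ p) l₂ r₂ P M
  single-right = entails λ where
    (s , m , c) → (swap-machines at ((r₁ ⊕ p) ∷ l₁ ∷ r₂ ∷ l₂ ∷ P ∷ M ∷ []))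
      ((single-left at machines) (entailed single-swap s , m , c))

  -- A load `l₁ + p` that is not moderate is not light, so `r₁ + p` is light. What remains is the
  -- compatibility of `r₁ + p` with `l₂`.
  single-immoderate : Single ∧ ∁ (Moderate (l₁ ⊕ p) l₂ r₂ P M) ⊢ Invariant l₁ (r₁ ⊕ p) l₂ r₂ P M
  single-immoderate = entails λ {ρ} → λ where
    (s@(((0≤l₁ , 0≤r₁ , 0≤l₂ , 0≤r₂ , T₁≤P , T₂≤P , P≤M) , c₁ , c₂ , m₁ , m₂ , (_ , k₃) , m₄) , 0≤p , p≤M , T≤P) , ¬m) →
      let 0≤M : ρ ⊨ id ≼ M
          0≤M = linear 1 (2 · 0≤p ⊞ p≤M) refl
          ¬light = (immoderate⇒heavy at ((l₁ ⊕ p) ∷ l₂ ∷ r₂ ∷ P ∷ M ∷ [])) (0≤r₂ , 0≤M , P≤M , ¬m)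
          m : ρ ⊨ Moderate (r₁ ⊕ p) r₂ l₂ P M
          m = (light⇒moderate at ((r₁ ⊕ p) ∷ r₂ ∷ l₂ ∷ P ∷ M ∷ []))
                (0≤l₂ , 0≤M , P≤M , entailed light-elsewhere (p≤M , T≤P , ¬light))
          c : ρ ⊨ Compatible (r₁ ⊕ p) l₂ P M
          c = case ¬m of λ where
            -- Here `l₂ < l₁ + p - 5M/18`, so `r₁ + p + l₂ < P + 2M/9`, and `P ≥ l₁ + p > 2M/3`.
            (inj₂ (_ , ¬k4 , ¬k6)) →
              inj₁ (linear 6 (6 · 0≤r₁ ⊞ 4 · 0≤r₂ ⊞ 9 · p≤M ⊞ 24 · T≤P ⊞ 2 · ¬k4 ⊞ ¬k6) refl)
            (inj₁ ¬b) →
              let b : ρ ⊨ 3 ⊠ (r₁ ⊕ p) ≼ 2 ⊠ P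
                  b = linear 2 (3 · p≤M ⊞ 6 · T≤P ⊞ 2 · P≤M ⊞ ¬b) refl
              -- Since `l₁ + p > 5M/6`, both `r₁ < P - 5M/6` and `r₁ + p < P - M/3`. With these the
              -- first two alternatives for `l₂` yield `3 l₂ + r₁ + p ≤ 3P`. The third yields
              -- balance, as `5M/18 < (l₁ + p)/3 ≤ P/3`.
              in case k₃ of λ where
                (inj₁ k)        → inj₂ (inj₂ (b , inj₂ (linear 6 (3 · p≤M ⊞ 6 · T≤P ⊞ ¬b ⊞ 2 · k) refl)))
                (inj₂ (inj₁ k)) → inj₂ (inj₂ (b , inj₂ (linear 2 (p≤M ⊞ 6 · T≤P ⊞ ¬b ⊞ 2 · k) refl)))
                (inj₂ (inj₂ k)) → inj₁ (linear 6 (6 · 0≤r₁ ⊞ 24 · T≤P ⊞ ¬b ⊞ k) refl)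
      in entailed single-right (s , m , c)

  -- The smaller load `r₂` is at most `P/2`, so the failure of balance forces `l₁ + p > 5P/6` and
  -- thus `r₁ < P/6`. It also forces `r₂ > P/3` and thus `l₂ < 2P/3`.
  single-incompatible : Single ∧ r₂ ≼ l₂ ∧ ∁ (Compatible (l₁ ⊕ p) r₂ P M) ⊢ Invariant l₁ (r₁ ⊕ p) l₂ r₂ P M
  single-incompatible = entails λ where
    ((((_ , _ , _ , 0≤r₂ , _ , T₂≤P , _) , _) , _) , r₂≤l₂ , _ , inj₁ r₂> , _) →
      refute (0≤r₂ ⊞ 2 · T₂≤P ⊞ 2 · r₂≤l₂ ⊞ r₂>) refl
    (s@(((0≤l₁ , 0≤r₁ , 0≤l₂ , 0≤r₂ , T₁≤P , T₂≤P , P≤M) , _) , 0≤p , p≤M , T≤P) , r₂≤l₂ , ¬d , inj₂ (¬f , _) , _) →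
      entailed single-right (s ,
        ( linear 4 (8 · 0≤p ⊞ 16 · p≤M ⊞ 24 · T≤P ⊞ 9 · T₂≤P ⊞ 9 · P≤M ⊞ 9 · r₂≤l₂ ⊞ ¬f) refl
        , inj₂ (inj₁ (linear 10 (20 · 0≤p ⊞ 25 · p≤M ⊞ 30 · T≤P ⊞ 2 · T₂≤P ⊞ 22 · r₂≤l₂ ⊞ 2 · ¬d ⊞ ¬f) refl))) ,
        -- `¬f` implies `18 (r₁ + p + l₂) < 18P + 4M`, which is at most `24P` once `P ≥ 2M/3`. For
        -- smaller `P` the pair is lopsided.
        (case decide (3 ⊠ P ≼ 2 ⊠ M) of λ where
          (inj₁ P≤) → inj₂ (inj₁
            ( linear 1 (3 · 0≤r₁ ⊞ 3 · T≤P ⊞ 3 · T₂≤P ⊞ ¬d) refl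
            , inj₁ (linear 1 (48 · 0≤r₁ ⊞ 12 · p≤M ⊞ 72 · T≤P ⊞ 36 · T₂≤P ⊞ 18 · r₂≤l₂ ⊞ 3 · ¬f ⊞ 4 · P≤) refl)))
          (inj₂ P>) → inj₁ (linear 6 (6 · 0≤r₁ ⊞ 9 · p≤M ⊞ 24 · T≤P ⊞ 18 · T₂≤P ⊞ ¬f ⊞ 2 · P>) refl)))

  single-ordered : Single ∧ r₂ ≼ l₂ ⊢ Invariant (l₁ ⊕ p) r₁ l₂ r₂ P M ∨ Invariant l₁ (r₁ ⊕ p) l₂ r₂ P M
  single-ordered = entails λ where
    (s , r₂≤l₂) → case decide (Moderate (l₁ ⊕ p) l₂ r₂ P M) of λ where
      (inj₂ ¬m) → inj₂ (entailed single-immoderate (s , ¬m))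
      (inj₁ m)  → case decide (Compatible (l₁ ⊕ p) r₂ P M) of λ where
        (inj₁ c)  → inj₁ (entailed single-left (s , m , c))
        (inj₂ ¬c) → inj₂ (entailed single-incompatible (s , r₂≤l₂ , ¬c))

  single : Single ⊢ Invariant (l₁ ⊕ p) r₁ l₂ r₂ P M ∨ Invariant l₁ (r₁ ⊕ p) l₂ r₂ P M
  single = entails λ s → case decide (r₂ ≼ l₂) of λ where
    (inj₁ r₂≤l₂) → entailed single-ordered (s , r₂≤l₂)
    (inj₂ l₂<r₂) →
      case (single-ordered at machines) (entailed single-swap s , weaken l₂<r₂) of λ where
        (inj₁ i) → inj₂ ((swap-machines at ((r₁ ⊕ p) ∷ l₁ ∷ r₂ ∷ l₂ ∷ P ∷ M ∷ [])) i)
        (inj₂ i) → inj₁ ((swap-machines at (r₁ ∷ (l₁ ⊕ p) ∷ r₂ ∷ l₂ ∷ P ∷ M ∷ [])) i)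

  -- Jobs of both scenarios

  Double DoubleLeft DoubleRight : Formula 7
  Double      = Invariant l₁ r₁ l₂ r₂ P M ∧ id ≼ p ∧ p ⊕ p ≼ M ∧ P ⊕ p ≼ M
  DoubleLeft  = Invariant (l₁ ⊕ p) r₁ (l₂ ⊕ p) r₂ (P ⊕ p) M
  DoubleRight = Invariant l₁ (r₁ ⊕ p) l₂ (r₂ ⊕ p) (P ⊕ p) M

  double-swap-machines : Double ⊢ Double [ machines ]
  double-swap-machines = entails λ where
    (inv , h) → (swap-machines at current) inv , h

  double-swap-scenarios : Double ⊢ Double [ scenarios ]
  double-swap-scenarios = entails λ where
    (inv , h) → (swap-scenarios at current) inv , h

  double-left :
    Double ∧ Moderate (l₁ ⊕ p) (l₂ ⊕ p) r₂ (P ⊕ p) M ∧ Moderate (l₂ ⊕ p) (l₁ ⊕ p) r₁ (P ⊕ p) M ∧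
    Compatible (l₁ ⊕ p) r₂ (P ⊕ p) M ∧ Compatible r₁ (l₂ ⊕ p) (P ⊕ p) M ⊢ DoubleLeft
  double-left = entails λ where
    ((((0≤l₁ , 0≤r₁ , 0≤l₂ , 0≤r₂ , T₁≤P , T₂≤P , P≤M) , c₁ , c₂ , m₁ , m₂ , m₃ , m₄) , 0≤p , p≤M , P+p≤M) ,
     m , m′ , c , c′) →
      (linear 1 (0≤l₁ ⊞ 0≤p) refl , 0≤r₁ , linear 1 (0≤l₂ ⊞ 0≤p) refl , 0≤r₂ ,
       linear 1 T₁≤P refl , linear 1 T₂≤P refl , P+p≤M) ,
      c , c′ , m ,
      (moderate-mono at (r₁ ∷ r₂ ∷ l₂ ∷ P ∷ M ∷ r₂ ∷ (l₂ ⊕ p) ∷ (P ⊕ p) ∷ M ∷ []))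
        (holds ≤-refl , linear 1 0≤p refl , linear 1 0≤p refl , holds ≤-refl , m₂) ,
      m′ ,
      (moderate-mono at (r₂ ∷ r₁ ∷ l₁ ∷ P ∷ M ∷ r₁ ∷ (l₁ ⊕ p) ∷ (P ⊕ p) ∷ M ∷ []))
        (holds ≤-refl , linear 1 0≤p refl , linear 1 0≤p refl , holds ≤-refl , m₄)

  double-right :
    Double ∧ Moderate (r₁ ⊕ p) (r₂ ⊕ p) l₂ (P ⊕ p) M ∧ Moderate (r₂ ⊕ p) (r₁ ⊕ p) l₁ (P ⊕ p) M ∧
    Compatible (r₁ ⊕ p) l₂ (P ⊕ p) M ∧ Compatible l₁ (r₂ ⊕ p) (P ⊕ p) M ⊢ DoubleRight
  double-right = entails λ where
    (d , h) → (swap-machines at ((r₁ ⊕ p) ∷ l₁ ∷ (r₂ ⊕ p) ∷ l₂ ∷ (P ⊕ p) ∷ M ∷ []))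
      ((double-left at machines) (entailed double-swap-machines d , h))

  -- `l₁ + p` and `r₂ + p` cannot both fail to be moderate: balance gives
  -- `l₁ + r₂ + 2p ≤ 4(P + p)/3 + 2p/3 ≤ 5M/3`, so they cannot both exceed `5M/6`. The other ways to
  -- fail contradict balance similarly.
  double-immoderate :
    Double ∧ Balanced l₁ r₂ P ∧ Balanced r₁ l₂ P ∧ ∁ (Moderate (l₁ ⊕ p) (l₂ ⊕ p) r₂ (P ⊕ p) M) ⊢ DoubleRight
  double-immoderate = entails λ {ρ} → λ where
    (d@(((0≤l₁ , 0≤r₁ , 0≤l₂ , 0≤r₂ , T₁≤P , T₂≤P , P≤M) , _) , 0≤p , p≤M , P+p≤M) , b₁ , b₂ , ¬m) →
      let 0≤M : ρ ⊨ id ≼ M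
          0≤M = linear 1 (2 · 0≤p ⊞ p≤M) refl
          ¬light = (immoderate⇒heavy at ((l₁ ⊕ p) ∷ (l₂ ⊕ p) ∷ r₂ ∷ (P ⊕ p) ∷ M ∷ [])) (0≤r₂ , 0≤M , P+p≤M , ¬m)
          light = (light-elsewhere at (l₁ ∷ r₁ ∷ l₂ ∷ r₂ ∷ (P ⊕ p) ∷ M ∷ p ∷ []))
                    (p≤M , linear 1 T₁≤P refl , ¬light)
          m : ρ ⊨ Moderate (r₂ ⊕ p) (r₁ ⊕ p) l₁ (P ⊕ p) M
          m = case decide (Moderate (r₂ ⊕ p) (r₁ ⊕ p) l₁ (P ⊕ p) M) of λ where
            (inj₁ m)  → m
            (inj₂ ¬n) → case ¬m , ¬n of λ where
              (inj₁ ¬b , inj₁ ¬c) → refute (2 · p≤M ⊞ 8 · P+p≤M ⊞ 2 · b₁ ⊞ ¬b ⊞ ¬c) refl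
              (inj₁ ¬b , inj₂ (¬k2 , ¬k4 , _)) →
                refute (9 · p≤M ⊞ 18 · P+p≤M ⊞ 6 · b₁ ⊞ 4 · ¬b ⊞ ¬k2 ⊞ 3 · ¬k4) refl
              (inj₂ (¬k2 , ¬k4 , _) , inj₁ ¬b) →
                refute (9 · p≤M ⊞ 18 · P+p≤M ⊞ 6 · b₁ ⊞ ¬k2 ⊞ 3 · ¬k4 ⊞ 4 · ¬b) refl
              (inj₂ (_ , ¬k4 , _) , inj₂ (¬k2 , ¬k4′ , _)) →
                refute (25 · p≤M ⊞ 10 · P+p≤M ⊞ 10 · b₁ ⊞ 12 · ¬k4 ⊞ 5 · ¬k2 ⊞ 3 · ¬k4′) refl
      in entailed double-right
           (d , (light⇒moderate at ((r₁ ⊕ p) ∷ (r₂ ⊕ p) ∷ l₂ ∷ (P ⊕ p) ∷ M ∷ [])) (0≤l₂ , 0≤M , P+p≤M , light) ,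
            m , inj₁ (linear 1 (0≤p ⊞ b₂) refl) , inj₁ (linear 1 (0≤p ⊞ b₁) refl))

  -- On either machine the job adds `p` once to each cross pair, while `4P/3` grows by `4p/3`.
  -- Balance survives, and only moderation decides.
  double-balanced : Double ∧ Balanced l₁ r₂ P ∧ Balanced r₁ l₂ P ⊢ DoubleLeft ∨ DoubleRight
  double-balanced = entails λ where
    (d@(_ , 0≤p , _) , b₁ , b₂) →
      case decide (Moderate (l₁ ⊕ p) (l₂ ⊕ p) r₂ (P ⊕ p) M)
         ,′ decide (Moderate (l₂ ⊕ p) (l₁ ⊕ p) r₁ (P ⊕ p) M) of λ where
        (inj₂ ¬m , _)       → inj₂ (entailed double-immoderate (d , b₁ , b₂ , ¬m))
        (inj₁ _ , inj₂ ¬m′) → inj₂ ((swap-scenarios at (l₂ ∷ (r₂ ⊕ p) ∷ l₁ ∷ (r₁ ⊕ p) ∷ (P ⊕ p) ∷ M ∷ []))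
          ((double-immoderate at scenarios)
            (entailed double-swap-scenarios d , linear 1 b₂ refl , linear 1 b₁ refl , ¬m′)))
        (inj₁ m , inj₁ m′)  → inj₁ (entailed double-left
          (d , m , m′ , inj₁ (linear 1 (0≤p ⊞ b₁) refl) , inj₁ (linear 1 (0≤p ⊞ b₂) refl)))

  -- If the job makes the pair balanced, it goes on top of `r₂`, where it fits:
  -- `6(r₂ + p) ≤ 4P + 6p ≤ 5M`. Otherwise it goes on top of `l₁`.
  double-lopsided : Double ∧ Lopsided l₁ r₂ P M ∧ ∁ (Balanced l₁ r₂ P) ⊢ DoubleLeft ∨ DoubleRight
  double-lopsided = entails λ {ρ} → λ where
    (d@(((0≤l₁ , 0≤r₁ , 0≤l₂ , 0≤r₂ , T₁≤P , T₂≤P , P≤M) , _) , 0≤p , p≤M , P+p≤M) , (r₂≤P , f) , ¬b) →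
      let 0≤M : ρ ⊨ id ≼ M
          0≤M = linear 1 (2 · 0≤p ⊞ p≤M) refl
          -- All four loads sum to at most `2P`, so the other cross pair has less than `2P/3`.
          b₂ : ρ ⊨ Balanced r₁ l₂ P
          b₂ = linear 1 (3 · 0≤r₂ ⊞ 3 · T₁≤P ⊞ 3 · T₂≤P ⊞ ¬b ⊞ r₂≤P) refl
      in case decide (Balanced l₁ (r₂ ⊕ p) (P ⊕ p)) of λ where
        (inj₁ b) → inj₂ (entailed double-right
          (d ,
           (light⇒moderate at ((r₁ ⊕ p) ∷ (r₂ ⊕ p) ∷ l₂ ∷ (P ⊕ p) ∷ M ∷ [])) (0≤l₂ , 0≤M , P+p≤M ,
             (case decide (3 ⊠ (r₁ ⊕ p) ≼ 2 ⊠ M) of λ where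
               (inj₁ h) → inj₁ h
               (inj₂ h) → inj₂ (linear 1 (7 · p≤M ⊞ 18 · T₁≤P ⊞ 8 · ¬b ⊞ 6 · r₂≤P ⊞ 2 · b ⊞ 3 · h) refl))) ,
           ( linear 1 (p≤M ⊞ 4 · P+p≤M ⊞ 2 · r₂≤P) refl
           , inj₂ (inj₁ (linear 3 (4 · p≤M ⊞ 2 · P+p≤M ⊞ 3 · ¬b ⊞ 5 · r₂≤P ⊞ b) refl))) ,
           inj₁ (linear 1 (0≤p ⊞ b₂) refl) , inj₁ b))
        (inj₂ ¬b′) →
          -- As the pair stays unbalanced, `p < 3 l₁ + 3 r₂ - 4P`. The alternatives in `f` turn this
          -- into `6(l₁ + p) < 5M` and `6(l₁ + p) < 5(P + p)`.
          let l₁≤M : ρ ⊨ 6 ⊠ (l₁ ⊕ p) ≼ 5 ⊠ M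
              l₁≤M = case f of λ where
                (inj₁ h) → linear 1 (6 · ¬b′ ⊞ h) refl
                (inj₂ h) → linear 1 (5 · P+p≤M ⊞ ¬b′ ⊞ 3 · h) refl
          in inj₁ (entailed double-left
          (d ,
           (l₁≤M , inj₂ (inj₁ (linear 3 (9 · 0≤r₁ ⊞ 9 · T₁≤P ⊞ P+p≤M ⊞ 2 · ¬b′ ⊞ l₁≤M) refl))) ,
           (light⇒moderate at ((l₂ ⊕ p) ∷ (l₁ ⊕ p) ∷ r₁ ∷ (P ⊕ p) ∷ M ∷ [])) (0≤r₁ , 0≤M , P+p≤M ,
             inj₂ (linear 1 (12 · 0≤r₁ ⊞ 2 · 0≤p ⊞ 12 · T₁≤P ⊞ 9 · T₂≤P ⊞ P+p≤M ⊞ 4 · ¬b′ ⊞ r₂≤P) refl)) ,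
           -- Each alternative in `f` gains the same multiple of `p` on both sides, so the pair
           -- remains lopsided.
           inj₂ (inj₁ (linear 1 (2 · 0≤p ⊞ r₂≤P) refl , (case f of λ where
             (inj₁ h) → inj₁ (linear 1 h refl)
             (inj₂ h) → inj₂ (linear 1 h refl)))) ,
           inj₁ (linear 1 (0≤p ⊞ b₂) refl)))

  double-unbalanced : Double ∧ ∁ (Balanced l₁ r₂ P) ⊢ DoubleLeft ∨ DoubleRight
  double-unbalanced = entails λ where
    (d@((_ , inj₁ b , _) , _) , ¬b)        → ⊥-elim (∁-sound (Balanced l₁ r₂ P) b ¬b)
    (d@((_ , inj₂ (inj₁ f) , _) , _) , ¬b) → entailed double-lopsided (d , f , ¬b)
    (d@((_ , inj₂ (inj₂ f) , _) , _) , ¬b) →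
      -- Swapping machines and scenarios together exchanges `l₁` with `r₂` and `r₁` with `l₂`.
      case (double-lopsided at (r₂ ∷ l₂ ∷ r₁ ∷ l₁ ∷ P ∷ M ∷ p ∷ []))
             ((double-swap-scenarios at machines) (entailed double-swap-machines d) , f , linear< 1 ¬b refl) of λ where
        (inj₁ i) → inj₂ ((swap-scenarios at (l₂ ∷ (r₂ ⊕ p) ∷ l₁ ∷ (r₁ ⊕ p) ∷ (P ⊕ p) ∷ M ∷ []))
                     ((swap-machines at ((r₂ ⊕ p) ∷ l₂ ∷ (r₁ ⊕ p) ∷ l₁ ∷ (P ⊕ p) ∷ M ∷ [])) i))
        (inj₂ i) → inj₁ ((swap-scenarios at ((l₂ ⊕ p) ∷ r₂ ∷ (l₁ ⊕ p) ∷ r₁ ∷ (P ⊕ p) ∷ M ∷ []))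
                     ((swap-machines at (r₂ ∷ (l₂ ⊕ p) ∷ r₁ ∷ (l₁ ⊕ p) ∷ (P ⊕ p) ∷ M ∷ [])) i))

  double : Double ⊢ DoubleLeft ∨ DoubleRight
  double = entails λ d → case decide (Balanced l₁ r₂ P) ,′ decide (Balanced r₁ l₂ P) of λ where
    (inj₂ ¬b , _)       → entailed double-unbalanced (d , ¬b)
    (inj₁ b₁ , inj₁ b₂) → entailed double-balanced (d , b₁ , b₂)
    (inj₁ _ , inj₂ ¬b)  →
      case (double-unbalanced at machines) (entailed double-swap-machines d , ¬b) of λ where
        (inj₁ i) → inj₂ ((swap-machines at ((r₁ ⊕ p) ∷ l₁ ∷ (r₂ ⊕ p) ∷ l₂ ∷ (P ⊕ p) ∷ M ∷ [])) i)
        (inj₂ i) → inj₁ ((swap-machines at (r₁ ∷ (l₁ ⊕ p) ∷ r₂ ∷ (l₂ ⊕ p) ∷ (P ⊕ p) ∷ M ∷ [])) i)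

-- The algorithm

record State : Set where
  field
    loads : Fin 2 → Fin 2 → ℚ
    bound : ℚ  -- twice a lower bound on the optimum
open State

total : (Fin 2 → Fin 2 → ℚ) → Fin 2 → ℚ
total f k = f k 0F + f k 1F

peak : (Fin 2 → Fin 2 → ℚ) → ℚ
peak f = total f 0F ⊔ total f 1F

-- A job that is in no scenario does not bound the optimum.
weight : Job 2 → ℚ
weight (p , s) = if s 0F then p else if s 1F then p else 0ℚ

share : Job 2 → Fin 2 → ℚ
share (p , s) k = if s k then p else 0ℚ

contribution : Job 2 → Fin 2 → Fin 2 → Fin 2 → ℚ
contribution (p , s) i k i′ = if s k then (if does (i ≟ i′) then p else 0ℚ) else 0ℚ

place : Job 2 → Fin 2 → State → State
place j i s = record
  { loads = f
  ; bound = bound s ⊔ (weight j + weight j) ⊔ peak f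
  }
  where
    f : Fin 2 → Fin 2 → ℚ
    f k i′ = loads s k i′ + contribution j i k i′

invariant : Formula 6
invariant = Invariant (var 0F) (var 1F) (var 2F) (var 3F) (var 4F) (var 5F)

record Admissible (l₁ r₁ l₂ r₂ P M : ℚ) : Set where
  constructor admissible
  field satisfied : (l₁ ∷ r₁ ∷ l₂ ∷ r₂ ∷ P ∷ M ∷ []) ⊨ invariant
open Admissible

admissible? : ∀ l₁ r₁ l₂ r₂ P M → Dec (Admissible l₁ r₁ l₂ r₂ P M)
admissible? l₁ r₁ l₂ r₂ P M with decide invariant {l₁ ∷ r₁ ∷ l₂ ∷ r₂ ∷ P ∷ M ∷ []}
... | inj₁ h = yes (admissible h)
... | inj₂ n = no λ h → ∁-sound invariant (satisfied h) n

Safe : State → Set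
Safe s = let f = loads s in
  Admissible (f 0F 0F) (f 0F 1F) (f 1F 0F) (f 1F 1F) (peak f) (bound s)

safe? : ∀ s → Dec (Safe s)
safe? s = admissible? _ _ _ _ _ _

prefer : ∀ {A : Set} → Dec A → Fin 2
prefer (yes _) = 0F
prefer (no _)  = 1F

prefer-sound : (Q : Fin 2 → Set) (d : Dec (Q 0F)) → Q 0F ⊎ Q 1F → Q (prefer d)
prefer-sound Q (yes q) _        = q
prefer-sound Q (no ¬q) (inj₁ q) = ⊥-elim (¬q q)
prefer-sound Q (no ¬q) (inj₂ q) = q

choose : State → Job 2 → Fin 2
choose s j = prefer (safe? (place j 0F s))

advance : State → Job 2 → State
advance s j = place j (choose s j) s

initial : State
initial = record { loads = λ _ _ → 0ℚ ; bound = 0ℚ }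

algorithm : OnlineAlg 2 2
algorithm history = choose (foldl advance initial history)

-- Preservation of the invariant

invariant-resp : ∀ {l₁ r₁ l₂ r₂ P M l₁′ r₁′ l₂′ r₂′ P′ M′} →
  l₁ ≡ l₁′ → r₁ ≡ r₁′ → l₂ ≡ l₂′ → r₂ ≡ r₂′ → P ≡ P′ → M ≡ M′ →
  Admissible l₁ r₁ l₂ r₂ P M → Admissible l₁′ r₁′ l₂′ r₂′ P′ M′
invariant-resp refl refl refl refl refl refl h = h

module _ {l₁ r₁ l₂ r₂ P M : ℚ} (safe : Admissible l₁ r₁ l₂ r₂ P M) where

  invariant-swap : Admissible l₂ r₂ l₁ r₁ P M
  invariant-swap = admissible (generalise (l₁ ∷ r₁ ∷ l₂ ∷ r₂ ∷ P ∷ M ∷ [])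
    (var 2F ∷ var 3F ∷ var 0F ∷ var 1F ∷ var 4F ∷ var 5F ∷ []) invariant (entailed swap-scenarios (satisfied safe)))

  invariant-raise : ∀ {P′ M′} → P ≤ P′ → M ≤ M′ → P′ ≤ M′ → Admissible l₁ r₁ l₂ r₂ P′ M′
  invariant-raise {P′} {M′} P≤ M≤ P′≤M′ =
    admissible (generalise ρ (var 0F ∷ var 1F ∷ var 2F ∷ var 3F ∷ var 6F ∷ var 7F ∷ []) invariant
      (entailed invariant-mono (holds P≤ , holds M≤ , holds P′≤M′ ,
        specialise ρ (var 0F ∷ var 1F ∷ var 2F ∷ var 3F ∷ var 4F ∷ var 5F ∷ []) invariant (satisfied safe))))
    where
      ρ : Env 8
      ρ = l₁ ∷ r₁ ∷ l₂ ∷ r₂ ∷ P ∷ M ∷ P′ ∷ M′ ∷ []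

  module _ {p : ℚ} (0≤p : 0ℚ ≤ p) (p≤M : p + p ≤ M) where
    private
      ρ : Env 7
      ρ = l₁ ∷ r₁ ∷ l₂ ∷ r₂ ∷ P ∷ M ∷ p ∷ []

      before : ρ ⊨ Invariant (var 0F) (var 1F) (var 2F) (var 3F) (var 4F) (var 5F)
      before = specialise ρ (var 0F ∷ var 1F ∷ var 2F ∷ var 3F ∷ var 4F ∷ var 5F ∷ []) invariant (satisfied safe)

    invariant-single : l₁ + (r₁ + p) ≤ P →
      Admissible (l₁ + p) r₁ l₂ r₂ P M ⊎ Admissible l₁ (r₁ + p) l₂ r₂ P M
    invariant-single T≤P =
      Sum.map (admissible ∘ generalise ρ ((var 0F ⊕ var 6F) ∷ var 1F ∷ var 2F ∷ var 3F ∷ var 4F ∷ var 5F ∷ []) invariant)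
              (admissible ∘ generalise ρ (var 0F ∷ (var 1F ⊕ var 6F) ∷ var 2F ∷ var 3F ∷ var 4F ∷ var 5F ∷ []) invariant)
              (entailed single (before , holds 0≤p , holds p≤M , holds T≤P))

    invariant-double : P + p ≤ M →
      Admissible (l₁ + p) r₁ (l₂ + p) r₂ (P + p) M ⊎
      Admissible l₁ (r₁ + p) l₂ (r₂ + p) (P + p) M
    invariant-double P+p≤M =
      Sum.map
        (admissible ∘ generalise ρ ((var 0F ⊕ var 6F) ∷ var 1F ∷ (var 2F ⊕ var 6F) ∷ var 3F ∷ (var 4F ⊕ var 6F) ∷ var 5F ∷ []) invariant)
        (admissible ∘ generalise ρ (var 0F ∷ (var 1F ⊕ var 6F) ∷ var 2F ∷ (var 3F ⊕ var 6F) ∷ (var 4F ⊕ var 6F) ∷ var 5F ∷ []) invariant)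
        (entailed double (before , holds 0≤p , holds p≤M , holds P+p≤M))

contribution-total : ∀ j i k → contribution j i k 0F + contribution j i k 1F ≡ share j k
contribution-total (p , b) 0F k with b k
... | true  = +-identityʳ p
... | false = refl
contribution-total (p , b) 1F k with b k
... | true  = +-identityˡ p
... | false = refl

total-place : ∀ j i s k → total (loads (place j i s)) k ≡ total (loads s) k + share j k
total-place j i s k =
  trans (interchange (loads s k 0F) (contribution j i k 0F) (loads s k 1F) (contribution j i k 1F))
        (cong (λ t → total (loads s) k + t) (contribution-total j i k))

peak-place : ∀ j i s → peak (loads (place j i s)) ≡
             (total (loads s) 0F + share j 0F) ⊔ (total (loads s) 1F + share j 1F)
peak-place j i s = cong₂ _⊔_ (total-place j i s 0F) (total-place j i s 1F)

p≤p+q : ∀ p q → 0ℚ ≤ q → p ≤ p + q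
p≤p+q p q 0≤q = subst (_≤ p + q) (+-identityʳ p) (+-monoʳ-≤ p 0≤q)

module _ (p : ℚ) (0≤p : 0ℚ ≤ p) (s : State) (safe : Safe s) where
  private
    l₁ = loads s 0F 0F
    r₁ = loads s 0F 1F
    l₂ = loads s 1F 0F
    r₂ = loads s 1F 1F
    T₁ = l₁ + r₁
    T₂ = l₂ + r₂

    Placed : Job 2 → Fin 2 → ℚ → ℚ → Set
    Placed j i = Admissible (l₁ + contribution j i 0F 0F) (r₁ + contribution j i 0F 1F)
                            (l₂ + contribution j i 1F 0F) (r₂ + contribution j i 1F 1F)

    +0 : ∀ q → q ≡ q + 0ℚ
    +0 q = sym (+-identityʳ q)

    T+0 : ∀ q → q ≤ q + 0ℚ
    T+0 q = p≤p+q q 0ℚ ≤-refl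

    T+p : ∀ q → q ≤ q + p
    T+p q = p≤p+q q p 0≤p

    raise : ∀ P q → T₁ ⊔ T₂ ≤ P → Admissible l₁ r₁ l₂ r₂ P (bound s ⊔ q ⊔ P)
    raise P q P≤ = invariant-raise safe P≤ (p≤q⇒p≤q⊔r P (p≤p⊔q (bound s) q)) (p≤q⊔p (bound s ⊔ q) P)

    q≤M : ∀ P q → q ≤ bound s ⊔ q ⊔ P
    q≤M P q = p≤q⇒p≤q⊔r P (p≤q⊔p (bound s) q)

    -- For a job of one scenario, `P` and `M` are raised to their new values first. For a common job
    -- only `M` is, because `P` must grow together with the loads to keep a lopsided pair lopsided.
    placed : ∀ b → let j = p , b
                       P = (T₁ + share j 0F) ⊔ (T₂ + share j 1F)
                       M = bound s ⊔ (weight j + weight j) ⊔ P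
                   in Placed j 0F P M ⊎ Placed j 1F P M
    placed b with b 0F | b 1F
    ... | false | false =
      inj₁ (invariant-resp (+0 l₁) (+0 r₁) (+0 l₂) (+0 r₂) refl refl
        (raise ((T₁ + 0ℚ) ⊔ (T₂ + 0ℚ)) (0ℚ + 0ℚ) (⊔-mono-≤ (T+0 T₁) (T+0 T₂))))
    ... | true  | false =
      Sum.map (invariant-resp refl (+0 r₁) (+0 l₂) (+0 r₂) refl refl)
              (invariant-resp (+0 l₁) refl (+0 l₂) (+0 r₂) refl refl)
        (invariant-single (raise P (p + p) (⊔-mono-≤ (T+p T₁) (T+0 T₂))) 0≤p (q≤M P (p + p))
          (p≤q⇒p≤q⊔r (T₂ + 0ℚ) (≤-reflexive (sym (+-assoc l₁ r₁ p)))))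
      where P = (T₁ + p) ⊔ (T₂ + 0ℚ)
    ... | false | true  =
      Sum.map (invariant-resp (+0 l₁) (+0 r₁) refl (+0 r₂) refl refl ∘ invariant-swap)
              (invariant-resp (+0 l₁) (+0 r₁) (+0 l₂) refl refl refl ∘ invariant-swap)
        (invariant-single (invariant-swap (raise P (p + p) (⊔-mono-≤ (T+0 T₁) (T+p T₂)))) 0≤p (q≤M P (p + p))
          (p≤q⇒p≤r⊔q (T₁ + 0ℚ) (≤-reflexive (sym (+-assoc l₂ r₂ p)))))
      where P = (T₁ + 0ℚ) ⊔ (T₂ + p)
    ... | true  | true  =
      Sum.map (invariant-resp refl (+0 r₁) refl (+0 r₂) P+p refl)
              (invariant-resp (+0 l₁) refl (+0 l₂) refl P+p refl)
        (invariant-double (invariant-raise safe ≤-refl (p≤q⇒p≤q⊔r P (p≤p⊔q (bound s) (p + p)))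
            (≤-trans (⊔-mono-≤ (T+p T₁) (T+p T₂)) P≤M))
          0≤p (q≤M P (p + p)) (≤-trans (≤-reflexive P+p) P≤M))
      where
        P = (T₁ + p) ⊔ (T₂ + p)
        P+p : (T₁ ⊔ T₂) + p ≡ P
        P+p = mono-≤-distrib-⊔ (+-monoˡ-≤ p) T₁ T₂
        P≤M : P ≤ bound s ⊔ (p + p) ⊔ P
        P≤M = p≤q⊔p (bound s ⊔ (p + p)) P

  safe-place : ∀ b → Safe (place (p , b) 0F s) ⊎ Safe (place (p , b) 1F s)
  safe-place b = Sum.map (convert 0F) (convert 1F) (placed b)
    where
      j = p , b
      convert : ∀ i → let P = (T₁ + share j 0F) ⊔ (T₂ + share j 1F) in
                Placed j i P (bound s ⊔ (weight j + weight j) ⊔ P) → Safe (place j i s)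
      convert i = invariant-resp refl refl refl refl (sym (peak-place j i s))
                    (cong (λ P → bound s ⊔ (weight j + weight j) ⊔ P) (sym (peak-place j i s)))

  safe-advance : ∀ b → Safe (advance s (p , b))
  safe-advance b = prefer-sound (λ i → Safe (place (p , b) i s)) (safe? (place (p , b) 0F s)) (safe-place b)

safe-initial : Safe initial
-- With all quantities zero the decision procedure evaluates to `yes`.
safe-initial = toWitness {a? = safe? initial} _

safe-foldl : ∀ s js → Safe s → All (λ j → 0ℚ ≤ proj₁ j) js → Safe (foldl advance s js)
safe-foldl s []             safe []           = safe
safe-foldl s ((p , b) ∷ js) safe (0≤p ∷ 0≤js) =
  safe-foldl (advance s (p , b)) js (safe-advance p 0≤p s safe b) 0≤js

-- The algorithm recomputes its state by replaying the history. Keeping `s` equal to that replay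
-- lets the induction extend the history job by job.
loads-run : ∀ history js k i {s} → foldl advance initial history ≡ s →
            loads (foldl advance s js) k i ≡ loads s k i + load (runFrom algorithm history js) k i
loads-run history []       k i {s} eq   = sym (+-identityʳ (loads s k i))
loads-run history (j ∷ js) k i {s} refl =
  trans (loads-run (history ++ (j ∷ [])) js k i (foldl-++ advance initial history (j ∷ [])))
        (+-assoc (loads s k i) (contribution j (choose s j) k i)
                 (load (runFrom algorithm (history ++ (j ∷ [])) js) k i))

-- Comparison with an arbitrary schedule

contribution-nonneg : ∀ j i k i′ → 0ℚ ≤ proj₁ j → 0ℚ ≤ contribution j i k i′
contribution-nonneg (p , b) i k i′ 0≤p with b k | does (i ≟ i′)
... | true  | true  = 0≤p
... | true  | false = ≤-refl
... | false | _     = ≤-refl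

share-contribution : ∀ j i k → share j k ≡ contribution j i k i
share-contribution (p , b) 0F k = refl
share-contribution (p , b) 1F k = refl

weight-≤ : ∀ {B} j → (∀ k → share j k ≤ B) → weight j ≤ B
weight-≤ (p , b) share≤ with b 0F | share≤ 0F
... | true  | p≤B = p≤B
... | false | _   = share≤ 1F

load-nonneg : ∀ σ k i → All (λ j → 0ℚ ≤ proj₁ j) (map proj₁ σ) → 0ℚ ≤ load {2} {2} σ k i
load-nonneg []            k i []           = ≤-refl
load-nonneg ((j , i′) ∷ σ) k i (0≤p ∷ 0≤σ) = +-mono-≤ (contribution-nonneg j i′ k i 0≤p) (load-nonneg σ k i 0≤σ)

total-∷ : ∀ j i σ k → total (load ((j , i) ∷ σ)) k ≡ share j k + total (load σ) k
total-∷ j i σ k = trans (interchange (contribution j i k 0F) (load σ k 0F) (contribution j i k 1F) (load σ k 1F))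
                        (cong (λ t → t + total (load σ) k) (contribution-total j i k))

-- Scenario totals do not depend on the assignment, so the totals placed so far plus those remaining
-- in `σ` stay constant. The weight of a job is at most the load of its machine in `σ`.
bound-≤ : ∀ O s σ → All (λ j → 0ℚ ≤ proj₁ j) (map proj₁ σ) → bound s ≤ O + O →
          (∀ k → total (loads s) k + total (load σ) k ≤ O + O) → (∀ k i → load σ k i ≤ O) →
          bound (foldl advance s (map proj₁ σ)) ≤ O + O
bound-≤ O s []            []          M≤ T≤ L≤ = M≤
bound-≤ O s ((j , i) ∷ σ) (0≤p ∷ 0≤σ) M≤ T≤ L≤ =
  bound-≤ O s′ σ 0≤σ (⊔-lub (⊔-lub M≤ (+-mono-≤ w≤O w≤O)) (⊔-lub (T₀≤ 0F) (T₀≤ 1F))) T′≤ L′≤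
  where
    s′ = advance s j

    T′≤ : ∀ k → total (loads s′) k + total (load σ) k ≤ O + O
    T′≤ k = subst (_≤ O + O) (sym eq) (T≤ k)
      where
        eq : total (loads s′) k + total (load σ) k ≡ total (loads s) k + total (load ((j , i) ∷ σ)) k
        eq = trans (cong (λ t → t + total (load σ) k) (total-place j (choose s j) s k))
            (trans (+-assoc (total (loads s) k) (share j k) (total (load σ) k))
                   (cong (λ t → total (loads s) k + t) (sym (total-∷ j i σ k))))

    T₀≤ : ∀ k → total (loads s′) k ≤ O + O
    T₀≤ k = ≤-trans (p≤p+q (total (loads s′) k) (total (load σ) k)
                      (+-mono-≤ (load-nonneg σ k 0F 0≤σ) (load-nonneg σ k 1F 0≤σ)))
                    (T′≤ k)

    L′≤ : ∀ k i′ → load σ k i′ ≤ O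
    L′≤ k i′ = ≤-trans (subst (_≤ contribution j i k i′ + load σ k i′) (+-identityˡ (load σ k i′))
                         (+-monoˡ-≤ (load σ k i′) (contribution-nonneg j i k i′ 0≤p)))
                       (L≤ k i′)

    w≤O : weight j ≤ O
    w≤O = weight-≤ j λ k → ≤-trans (≤-reflexive (share-contribution j i k))
      (≤-trans (p≤p+q (contribution j i k i) (load σ k i) (load-nonneg σ k i 0≤σ)) (L≤ k i))

load≤makespan : ∀ σ k i → load {2} {2} σ k i ≤ makespan σ
load≤makespan σ = λ where
    0F 0F → p≤p⊔q a (b ⊔ (c ⊔ (d ⊔ 0ℚ)))
    0F 1F → p≤q⇒p≤r⊔q a (p≤p⊔q b (c ⊔ (d ⊔ 0ℚ)))
    1F 0F → p≤q⇒p≤r⊔q a (p≤q⇒p≤r⊔q b (p≤p⊔q c (d ⊔ 0ℚ)))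
    1F 1F → p≤q⇒p≤r⊔q a (p≤q⇒p≤r⊔q b (p≤q⇒p≤r⊔q c (p≤p⊔q d 0ℚ)))
  where
    a = load σ 0F 0F
    b = load σ 0F 1F
    c = load σ 1F 0F
    d = load σ 1F 1F

makespan-lub : ∀ σ {B} → 0ℚ ≤ B → (∀ k i → load {2} {2} σ k i ≤ B) → makespan σ ≤ B
makespan-lub σ 0≤B L≤ = ⊔-lub (L≤ 0F 0F) (⊔-lub (L≤ 0F 1F) (⊔-lub (L≤ 1F 0F) (⊔-lub (L≤ 1F 1F) 0≤B)))

-- Certificates have natural coefficients, so the ratio enters as `3t = 5O`. The sums ending in `0ℚ`
-- are the values of `3 ⊠ e` and `5 ⊠ e`.
five-thirds : ∀ O → let t = (+ 5 / 3) * O in t + (t + (t + 0ℚ)) ≡ O + (O + (O + (O + (O + 0ℚ))))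
five-thirds = solve 1 (λ x → let t = con (+ 5 / 3) :* x in
  t :+ (t :+ (t :+ con 0ℚ)) := x :+ (x :+ (x :+ (x :+ (x :+ con 0ℚ))))) refl
  where open +-*-Solver

load≤five-thirds : ∀ w M O → (w ∷ M ∷ []) ⊨ 6 ⊠ var 0F ≼ 5 ⊠ var 1F → M ≤ O + O → w ≤ (+ 5 / 3) * O
load≤five-thirds w M O w≤M M≤O =
  compare (linear {ρ = ρ} {a = var 0F} {b = var 3F} 6
    (specialise ρ (var 0F ∷ var 1F ∷ []) (6 ⊠ var 0F ≼ 5 ⊠ var 1F) w≤M ⊞ 5 · M≤2O ⊞ 2 · O≤t) refl)
  where
    ρ : Env 4
    ρ = w ∷ M ∷ O ∷ (+ 5 / 3) * O ∷ []
    M≤2O : Holds weak ρ (var 1F) (var 2F ⊕ var 2F)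
    M≤2O = holds M≤O
    O≤t : Holds weak ρ (5 ⊠ var 2F) (3 ⊠ var 3F)
    O≤t = holds (≤-reflexive (sym (five-thirds O)))

safe-loads : ∀ s O → Safe s → bound s ≤ O + O → ∀ k i → loads s k i ≤ (+ 5 / 3) * O
safe-loads s O (admissible (_ , _ , _ , (m₁ , _) , (m₂ , _) , (m₃ , _) , (m₄ , _))) M≤ = λ where
    0F 0F → load≤five-thirds (f 0F 0F) (bound s) O (generalise ρ (var 0F ∷ var 5F ∷ []) φ m₁) M≤
    0F 1F → load≤five-thirds (f 0F 1F) (bound s) O (generalise ρ (var 1F ∷ var 5F ∷ []) φ m₂) M≤
    1F 0F → load≤five-thirds (f 1F 0F) (bound s) O (generalise ρ (var 2F ∷ var 5F ∷ []) φ m₃) M≤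
    1F 1F → load≤five-thirds (f 1F 1F) (bound s) O (generalise ρ (var 3F ∷ var 5F ∷ []) φ m₄) M≤
  where
    f = loads s
    ρ : Env 6
    ρ = f 0F 0F ∷ f 0F 1F ∷ f 1F 0F ∷ f 1F 1F ∷ peak f ∷ bound s ∷ []
    φ : Formula 2
    φ = 6 ⊠ var 0F ≼ 5 ⊠ var 1F

theorem1 : Σ (OnlineAlg 2 2) λ alg →
    (js : List (Job 2)) → All (λ j → 0ℚ ≤ proj₁ j) js →
    (σ : List (Job 2 × Fin 2)) → map proj₁ σ ≡ js →
    makespan (run alg js) ≤ (+ 5 / 3) * makespan σ
theorem1 = algorithm , λ where
  js 0≤js σ refl →
    let O = makespan σ
        final = foldl advance initial js
        0≤O : 0ℚ ≤ O
        0≤O = ≤-trans (load-nonneg σ 0F 0F 0≤js) (load≤makespan σ 0F 0F)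
        bounded : bound final ≤ O + O
        bounded = bound-≤ O initial σ 0≤js (+-mono-≤ 0≤O 0≤O)
          (λ k → ≤-trans (≤-reflexive (+-identityˡ (total (load σ) k)))
                         (+-mono-≤ (load≤makespan σ k 0F) (load≤makespan σ k 1F)))
          (load≤makespan σ)
    in makespan-lub (run algorithm js)
         -- The makespan is a fold starting at `0ℚ`, so the bound itself must be nonnegative.
         (≤-trans (≤-reflexive (sym (*-zeroʳ (+ 5 / 3)))) (*-monoˡ-≤-nonNeg (+ 5 / 3) 0≤O))
         (λ k i → subst (_≤ (+ 5 / 3) * O)
           (trans (loads-run [] js k i refl) (+-identityˡ (load (run algorithm js) k i)))
           (safe-loads final O (safe-foldl initial js safe-initial 0≤js) bounded k i))
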